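{- Let $R$ be a principal ideal domain and let $I=gR\subsetneq R$ be a proper, non-prime ideal such that $Q:=R/I$ is finite. Suppose that $g$ has exactly one prime factor up to association, i.e. $g=u\cdot p_1^{m_1}$ with $u$ a unit, $p_1$ a prime element and $m_1\ge 1$ an integer. Then the zero divisor graph $\Gamma(Q)$ satisfies \[\dim_{TH}(\Gamma(Q))=\mathrm{box}(\Gamma(Q))=\begin{cases}0 & \text{if } m_1\le 2,\\ 1 & \text{if } m_1\ge 3.\end{cases}\]
   Context: Rings are commutative and non-zero with $1$. For a ring $Q$, $Z(Q)$ is the set of $r\in Q$ for which there is $s\in Q\setminus\{0\}$ with $rs=0$. The zero divisor graph $\Gamma(Q)$ has vertex set $Z(Q)\setminus\{0\}$; two distinct vertices $r,s$ are adjacent iff $rs=0$. The boxicity $\mathrm{box}(G)$ of a finite simple graph $G$ is the minimum integer $d\ge 0$ such that there exist $d$ interval graphs $I_1,\dots,I_d$ on $V(G)$ with $E(G)=\bigcap_{j=1}^d E(I_j)$. For a finite set $V$, $\alpha\colon V\to\mathbb{R}$ and $S\in\mathbb{R}$, the threshold graph $T(\alpha,S)$ has vertex set $V$ and edges all $\{v,w\}$, $v\neq w$, with $\alpha(v)+\alpha(w)\ge S$; a graph is a threshold graph if it is of this form. The threshold dimension $\dim_{TH}(G)$ is the minimum $d\ge 0$ such that there exist $d$ threshold graphs $H_1,\dots,H_d$ on $V(G)$ with $E(G)=\bigcap_{j=1}^d E(H_j)$. In both definitions the empty intersection ($d=0$) is the set of all pairs of vertices, so the parameter is $0$ exactly for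 complete graphs (including the graph with no vertices). -}

module Defs where

open import Algebra.Bundles using (CommutativeRing; Semiring)
open import Algebra.Definitions.RawMagma using (_,_)
import Algebra.Definitions.RawSemiring as RawSemiringDefinitions
import Algebra.Properties.AbelianGroup as AbelianGroupProperties
import Algebra.Properties.CommutativeSemigroup as CommutativeSemigroupProperties
import Algebra.Properties.Ring as RingProperties
import Algebra.Properties.Semigroup.Divisibility as SemigroupDivisibility
import Algebra.Properties.Semiring.Divisibility as SemiringDivisibility
open import Data.Fin.Base using (Fin)
import Data.Nat.Base as ℕ
open import Data.Nat.Base using (ℕ)
import Data.Nat.Properties as ℕₚ
open import Data.Product.Base using (∃-syntax; Σ-syntax; _×_; _,_; proj₁)
open import Data.Rational.Base using (ℚ; ½; ∣_∣; Positive)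
import Data.Rational.Properties as ℚₚ
open import Data.Sum.Base using (_⊎_)
open import Function.Bundles using (Func; Inverse; _⇔_)
open import Level using (Level; 0ℓ; _⊔_; suc)
open import Relation.Binary.Bundles using (Setoid)
open import Relation.Binary.Core using (Rel)
open import Relation.Binary.Definitions using (Symmetric; _Respects_; _Respects₂_)
import Relation.Binary.Construct.On as On
open import Relation.Binary.PropositionalEquality.Core as ≡ using (_≡_; cong; subst)
import Relation.Binary.PropositionalEquality.Properties as ≡ₚ
import Relation.Binary.Reasoning.Setoid as SetoidReasoning
open import Relation.Nullary.Negation.Core using (¬_)
open import Relation.Unary using (Pred; _∈_; _≐_)

private
  variable
    c ℓ v p : Level

-- Real numbers are Cauchy sequences of rationals; _≤ᴿ_ and _≈ᴿ_ are the
-- order and equality of their limits.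

module _ where

  open import Data.Rational.Base using (_+_; _*_; _-_; -_; _≤_)

  record ℝ : Set where
    constructor mkℝ
    field
      seq    : ℕ → ℚ
      cauchy : ∀ ε → Positive ε →
               ∃[ N ] ∀ m n → N ℕ.≤ m → N ℕ.≤ n → ∣ seq m - seq n ∣ ≤ ε

  open ℝ

  infix 4 _≤ᴿ_ _≈ᴿ_
  infixl 6 _+ᴿ_

  _≤ᴿ_ : Rel ℝ 0ℓ
  x ≤ᴿ y = ∀ ε → Positive ε → ∃[ N ] ∀ n → N ℕ.≤ n → seq x n ≤ seq y n + ε

  _≈ᴿ_ : Rel ℝ 0ℓ
  x ≈ᴿ y = x ≤ᴿ y × y ≤ᴿ x

  private
    ½*_ : ℚ → ℚ
    ½* ε = ½ * ε

    ½*-pos : ∀ ε → Positive ε → Positive (½* ε)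
    ½*-pos ε ε>0 = ℚₚ.pos*pos⇒pos ½ ε {{ε>0}}

    ½*+½* : ∀ ε → ½* ε + ½* ε ≡ ε
    ½*+½* ε = ≡.trans (≡.sym (ℚₚ.*-distribʳ-+ ε ½ ½)) (ℚₚ.*-identityˡ ε)

    +-interchange : ∀ a b x y → (a + b) + (x + y) ≡ (a + x) + (b + y)
    +-interchange a b x y = ≡.trans (ℚₚ.+-assoc a b (x + y))
      (≡.trans (cong (a +_) (≡.trans (≡.sym (ℚₚ.+-assoc b x y))
        (≡.trans (cong (_+ y) (ℚₚ.+-comm b x)) (ℚₚ.+-assoc x b y))))
      (≡.sym (ℚₚ.+-assoc a x (b + y))))

    ≤ᴿ-refl : ∀ {x} → x ≤ᴿ x
    ≤ᴿ-refl {x} ε ε>0 = 0 , λ n _ →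
      subst (_≤ seq x n + ε) (ℚₚ.+-identityʳ (seq x n))
        (ℚₚ.+-monoʳ-≤ (seq x n) (ℚₚ.<⇒≤ (ℚₚ.positive⁻¹ ε {{ε>0}})))

    ≤ᴿ-trans : ∀ {x y z} → x ≤ᴿ y → y ≤ᴿ z → x ≤ᴿ z
    ≤ᴿ-trans {x} {y} {z} x≤y y≤z ε ε>0
      with x≤y (½* ε) (½*-pos ε ε>0) | y≤z (½* ε) (½*-pos ε ε>0)
    ... | M , f | N , g = M ℕ.⊔ N , λ n M⊔N≤n →
      ℚₚ.≤-trans (f n (ℕₚ.≤-trans (ℕₚ.m≤m⊔n M N) M⊔N≤n))
        (subst (seq y n + ½* ε ≤_)
          (≡.trans (ℚₚ.+-assoc (seq z n) (½* ε) (½* ε)) (cong (seq z n +_) (½*+½* ε)))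
          (ℚₚ.+-monoˡ-≤ (½* ε) (g n (ℕₚ.≤-trans (ℕₚ.m≤n⊔m M N) M⊔N≤n))))

  ℝ-setoid : Setoid 0ℓ 0ℓ
  ℝ-setoid = record
    { Carrier       = ℝ
    ; _≈_           = _≈ᴿ_
    ; isEquivalence = record
      { refl  = λ {x} → ≤ᴿ-refl {x} , ≤ᴿ-refl {x}
      ; sym   = λ (x≤y , y≤x) → y≤x , x≤y
      ; trans = λ {x} {y} {z} (x≤y , y≤x) (y≤z , z≤y) →
          ≤ᴿ-trans {x} {y} {z} x≤y y≤z , ≤ᴿ-trans {z} {y} {x} z≤y y≤x
      }
    }

  _+ᴿ_ : ℝ → ℝ → ℝ
  seq (x +ᴿ y) n = seq x n + seq y n
  cauchy (x +ᴿ y) ε ε>0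
    with cauchy x (½* ε) (½*-pos ε ε>0) | cauchy y (½* ε) (½*-pos ε ε>0)
  ... | M , f | N , g = M ℕ.⊔ N , λ m n M⊔N≤m M⊔N≤n →
    subst (∣ (seq x m + seq y m) - (seq x n + seq y n) ∣ ≤_) (½*+½* ε)
      (subst (λ q → ∣ q ∣ ≤ ½* ε + ½* ε) (≡.sym (rearrange m n))
        (ℚₚ.≤-trans (ℚₚ.∣p+q∣≤∣p∣+∣q∣ (seq x m - seq x n) (seq y m - seq y n))
          (ℚₚ.+-mono-≤
            (f m n (ℕₚ.≤-trans (ℕₚ.m≤m⊔n M N) M⊔N≤m) (ℕₚ.≤-trans (ℕₚ.m≤m⊔n M N) M⊔N≤n))
            (g m n (ℕₚ.≤-trans (ℕₚ.m≤n⊔m M N) M⊔N≤m) (ℕₚ.≤-trans (ℕₚ.m≤n⊔m M N) M⊔N≤n)))))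
    where
    rearrange : ∀ m n → (seq x m + seq y m) - (seq x n + seq y n)
                      ≡ (seq x m - seq x n) + (seq y m - seq y n)
    rearrange m n = ≡.trans
      (cong (seq x m + seq y m +_) (ℚₚ.neg-distrib-+ (seq x n) (seq y n)))
      (+-interchange (seq x m) (seq y m) (- seq x n) (- seq y n))

-- As the carriers below are setoids, "finite" means: in bijection with
-- Fin n up to the setoid equality.

IsFinite : Setoid v ℓ → Set (v ⊔ ℓ)
IsFinite V = ∃[ n ] Inverse V (≡ₚ.setoid (Fin n))

record SimpleGraph (V : Setoid v ℓ) : Set (v ⊔ suc ℓ) where
  open Setoid V using (Carrier; _≈_)
  field
    Adj    : Rel Carrier ℓ
    sym    : Symmetric Adj
    irrefl : ∀ {x y} → Adj x y → ¬ (x ≈ y)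
    resp   : Adj Respects₂ _≈_

module _ {V : Setoid v ℓ} where

  open Setoid V using (Carrier; _≈_)
  open SimpleGraph using (Adj)

  record IsIntervalGraph (G : SimpleGraph V) : Set (v ⊔ ℓ) where
    field
      left right : Func V ℝ-setoid
      left≤right : ∀ x → Func.to left x ≤ᴿ Func.to right x

    _∈[_] : ℝ → Carrier → Set
    t ∈[ x ] = Func.to left x ≤ᴿ t × t ≤ᴿ Func.to right x

    field
      adj⇔ : ∀ x y → Adj G x y ⇔ (¬ (x ≈ y) × ∃[ t ] t ∈[ x ] × t ∈[ y ])

  record IsThresholdGraph (G : SimpleGraph V) : Set (v ⊔ ℓ) where
    field
      α    : Func V ℝ-setoid
      S    : ℝ
      adj⇔ : ∀ x y → Adj G x y ⇔ (¬ (x ≈ y) × S ≤ᴿ Func.to α x +ᴿ Func.to α y)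

  -- The conjunct ¬ (x ≈ y) matters only for d = 0, where it makes the
  -- empty intersection the set of all pairs of distinct vertices.

  IsIntersection : ∀ {d} → SimpleGraph V → (Fin d → SimpleGraph V) → Set (v ⊔ ℓ)
  IsIntersection G H = ∀ x y → Adj G x y ⇔ (¬ (x ≈ y) × ∀ j → Adj (H j) x y)

  IsIntersectionOf : (SimpleGraph V → Set p) → SimpleGraph V → ℕ → Set (v ⊔ suc ℓ ⊔ p)
  IsIntersectionOf P G d =
    Σ[ H ∈ (Fin d → SimpleGraph V) ] (∀ j → P (H j)) × IsIntersection G H

IsMinimum : Pred ℕ p → ℕ → Set p
IsMinimum P d = P d × ∀ d′ → P d′ → d ℕ.≤ d′

HasBoxicity : {V : Setoid v ℓ} → SimpleGraph V → ℕ → Set (v ⊔ suc ℓ)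
HasBoxicity G = IsMinimum (IsIntersectionOf IsIntervalGraph G)

HasThresholdDimension : {V : Setoid v ℓ} → SimpleGraph V → ℕ → Set (v ⊔ suc ℓ)
HasThresholdDimension G = IsMinimum (IsIntersectionOf IsThresholdGraph G)

module _ (R : CommutativeRing c ℓ) where

  open CommutativeRing R
  open RawSemiringDefinitions (Semiring.rawSemiring semiring) using (_∣_)

  record Ideal p : Set (c ⊔ ℓ ⊔ suc p) where
    field
      Member   : Pred Carrier p
      resp     : Member Respects _≈_
      0∈       : 0# ∈ Member
      +-closed : ∀ {x y} → x ∈ Member → y ∈ Member → (x + y) ∈ Member
      *-closed : ∀ r {x} → x ∈ Member → (r * x) ∈ Member

  open Ideal using (Member)

  IsProper : Ideal p → Set (c ⊔ p)
  IsProper I = ¬ (∀ x → x ∈ Member I)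

  record IsPrimeIdeal (I : Ideal p) : Set (c ⊔ p) where
    field
      proper : IsProper I
      split  : ∀ {x y} → (x * y) ∈ Member I → x ∈ Member I ⊎ y ∈ Member I

  ⟨_⟩ : Carrier → Ideal (c ⊔ ℓ)
  ⟨ g ⟩ = record
    { Member   = g ∣_
    ; resp     = ∣-respʳ-≈
    ; 0∈       = g ∣0
    ; +-closed = λ { (a , ag≈x) (b , bg≈y) →
        (a + b) , trans (distribʳ g a b) (+-cong ag≈x bg≈y) }
    ; *-closed = λ r → x∣ʳy⇒x∣ʳzy r
    }
    where
    open SemigroupDivisibility *-semigroup using (x∣ʳy⇒x∣ʳzy)
    open SemiringDivisibility semiring using (_∣0; ∣-respʳ-≈)

  IsUnit : Pred Carrier (c ⊔ ℓ)
  IsUnit u = u ∣ 1#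

  -- The membership predicates range over the level c ⊔ ℓ of _∣_, the one
  -- at which every principal ideal lives.  All ideals are meant, not only
  -- those with decidable membership, so the condition has its classical
  -- strength (it implies excluded middle at level c ⊔ ℓ).

  record IsPrincipalIdealDomain : Set (suc (c ⊔ ℓ)) where
    field
      1≉0          : ¬ (1# ≈ 0#)
      xy≈0⇒x≈0∨y≈0 : ∀ {x y} → x * y ≈ 0# → x ≈ 0# ⊎ y ≈ 0#
      principal    : ∀ (I : Ideal (c ⊔ ℓ)) → ∃[ g ] Member I ≐ Member ⟨ g ⟩

module _ (R : CommutativeRing c ℓ) where

  open CommutativeRing R
  open Ideal

  private
    open AbelianGroupProperties +-abelianGroup using (x≈y⇒x∙y⁻¹≈ε; ⁻¹-anti-homo‿-; ⁻¹-∙-comm)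
    open CommutativeSemigroupProperties +-commutativeSemigroup using (interchange)
    open RingProperties ring using (-1*x≈-x; -‿distribʳ-*)
    open SetoidReasoning setoid

    telescope : ∀ x y z → (x - y) + (y - z) ≈ x - z
    telescope x y z = begin
      (x - y) + (y - z)      ≈⟨ +-assoc x (- y) (y - z) ⟩
      x + (- y + (y - z))    ≈⟨ +-congˡ (+-assoc (- y) y (- z)) ⟨
      x + ((- y + y) - z)    ≈⟨ +-congˡ (+-congʳ (-‿inverseˡ y)) ⟩
      x + (0# - z)           ≈⟨ +-congˡ (+-identityˡ (- z)) ⟩
      x - z                  ∎

    +-minus : ∀ x y u v → (x - y) + (u - v) ≈ (x + u) - (y + v)
    +-minus x y u v = trans (interchange x (- y) u (- v)) (+-congˡ (⁻¹-∙-comm y v))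

    *-minus : ∀ a x y → a * (x - y) ≈ a * x - a * y
    *-minus a x y = trans (distribˡ a x (- y)) (+-congˡ (sym (-‿distribʳ-* a y)))

    product-minus : ∀ x y u v → u * (x - y) + y * (u - v) ≈ x * u - y * v
    product-minus x y u v = begin
      u * (x - y) + y * (u - v)              ≈⟨ +-cong (*-minus u x y) (*-minus y u v) ⟩
      (u * x - u * y) + (y * u - y * v)      ≈⟨ +-cong (+-cong (*-comm u x) (-‿cong (*-comm u y))) refl ⟩
      (x * u - y * u) + (y * u - y * v)      ≈⟨ telescope (x * u) (y * u) (y * v) ⟩
      x * u - y * v                          ∎

  infixl 7 _/_

  _/_ : Ideal R p → CommutativeRing c p
  _/_ I = record
    { Carrier = Carrier
    ; _≈_     = λ x y → (x - y) ∈ Member I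
    ; _+_     = _+_
    ; _*_     = _*_
    ; -_      = -_
    ; 0#      = 0#
    ; 1#      = 1#
    ; isCommutativeRing = record
      { isRing = record
        { +-isAbelianGroup = record
          { isGroup = record
            { isMonoid = record
              { isSemigroup = record
                { isMagma = record
                  { isEquivalence = record
                    { refl  = lift refl
                    ; sym   = λ {x} {y} x~y → resp I (⁻¹-anti-homo‿- x y) (neg-closed x~y)
                    ; trans = λ {x} {y} {z} x~y y~z →
                        resp I (telescope x y z) (+-closed I x~y y~z)
                    }
                  ; ∙-cong = λ {x} {y} {u} {v} x~y u~v →
                      resp I (+-minus x y u v) (+-closed I x~y u~v)
                  }
                ; assoc = λ x y z → lift (+-assoc x y z)
                }
              ; identity = (λ x → lift (+-identityˡ x)) , (λ x → lift (+-identityʳ x))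
              }
            ; inverse = (λ x → lift (-‿inverseˡ x)) , (λ x → lift (-‿inverseʳ x))
            ; ⁻¹-cong = λ {x} {y} x~y → resp I (sym (⁻¹-∙-comm x (- y))) (neg-closed x~y)
            }
          ; comm = λ x y → lift (+-comm x y)
          }
        ; *-cong = λ {x} {y} {u} {v} x~y u~v →
            resp I (product-minus x y u v)
              (+-closed I (*-closed I u x~y) (*-closed I y u~v))
        ; *-assoc = λ x y z → lift (*-assoc x y z)
        ; *-identity = (λ x → lift (*-identityˡ x)) , (λ x → lift (*-identityʳ x))
        ; distrib = (λ x y z → lift (distribˡ x y z)) , (λ x y z → lift (distribʳ x y z))
        }
      ; *-comm = λ x y → lift (*-comm x y)
      }
    }
    where
    lift : ∀ {x y} → x ≈ y → (x - y) ∈ Member I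
    lift x≈y = resp I (sym (x≈y⇒x∙y⁻¹≈ε x≈y)) (0∈ I)

    neg-closed : ∀ {x} → x ∈ Member I → (- x) ∈ Member I
    neg-closed {x} x∈I = resp I (-1*x≈-x x) (*-closed I (- 1#) x∈I)

module _ (Q : CommutativeRing c ℓ) where

  open CommutativeRing Q

  IsZeroDivisor : Pred Carrier (c ⊔ ℓ)
  IsZeroDivisor r = ∃[ s ] ¬ (s ≈ 0#) × r * s ≈ 0#

  ZeroDivisorVertices : Setoid (c ⊔ ℓ) ℓ
  ZeroDivisorVertices = record
    { Carrier       = ∃[ r ] IsZeroDivisor r × ¬ (r ≈ 0#)
    ; _≈_           = λ r s → proj₁ r ≈ proj₁ s
    ; isEquivalence = On.isEquivalence proj₁ isEquivalence
    }

  Γ : SimpleGraph ZeroDivisorVertices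
  Γ = record
    { Adj    = λ (r , _) (s , _) → ¬ (r ≈ s) × r * s ≈ 0#
    ; sym    = λ {(r , _)} {(s , _)} (r≉s , rs≈0) →
        (λ s≈r → r≉s (sym s≈r)) , trans (*-comm s r) rs≈0
    ; irrefl = proj₁
    ; resp   =
        (λ s≈t (r≉s , rs≈0) →
          (λ r≈t → r≉s (trans r≈t (sym s≈t))) , trans (*-congˡ (sym s≈t)) rs≈0) ,
        (λ r≈t (r≉s , rs≈0) →
          (λ t≈s → r≉s (trans r≈t t≈s)) , trans (*-congʳ (sym r≈t)) rs≈0)
    }

{-# OPTIONS --safe #-}

-- Let v(x) ≤ m be the largest k ≤ m with pᵏ ∣ x, where m = m₁.  Then x y = 0
-- in Q = R / (pᵐ) iff m ≤ v(x) + v(y), so Γ(Q) is a threshold graph with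
-- weights v.  Enumerating Q by indices i < n, it is also an interval graph:
-- a vertex with 2 v < m gets the point v n + i, and one with 2 v ≥ m the
-- interval [(m − v) n , m n].  Every vertex is divisible by p, so Γ(Q) is
-- complete for m ≤ 2, whereas for m ≥ 3 the vertices p and p + pᵐ⁻¹ are distinct
-- and not adjacent.

module Submission where

open import Defs
open import Algebra.Bundles using (CommutativeRing; Semiring)
open import Algebra.Definitions.RawMagma using (_,_)
open import Algebra.Definitions.RawSemiring using (Prime; _^_)
import Algebra.Properties.AbelianGroup as AbelianGroupProperties
import Algebra.Properties.CommutativeSemigroup as CommutativeSemigroupProperties
import Algebra.Properties.CommutativeSemigroup.Divisibility as CommutativeSemigroupDivisibility
import Algebra.Properties.Group as GroupProperties
import Algebra.Properties.Monoid.Mult as MonoidMult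
import Algebra.Properties.Ring as RingProperties
import Algebra.Properties.Semiring.Divisibility as SemiringDivisibility
import Algebra.Properties.Semiring.Exp as SemiringExp
open import Data.Fin.Base using (Fin; zero; toℕ)
import Data.Fin.Properties as Fin
import Data.Nat.Base as ℕ
open import Data.Nat.Base using (ℕ; zero; suc; _∸_; _⊔_; _≤_; _<_; z≤n; s≤s)
import Data.Nat.Properties as ℕₚ
open import Data.Nat.Properties using
  ( _≤?_; ≤-refl; ≤-reflexive; ≤-trans; ≤-antisym; ≤-total; ≤∧≢⇒<; <⇒≤; ≰⇒>; m<1+n⇒m≤n
  ; m≤n⇒m≤1+n; m≤m+n; m≤n+m; m≤m⊔n; m≤n⊔m; ⊔-lub; m∸n≤m; m≤n+m∸n; m∸n+n≡m; m≤n+o⇒m∸n≤o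
  ; +-mono-≤; +-monoˡ-≤; +-monoʳ-≤; +-monoʳ-<; +-cancelˡ-≡; +-suc; *-monoˡ-≤; *-cancelʳ-<
  )
open import Data.Product.Base using (_×_; _,_; proj₁; proj₂; ∃-syntax)
import Data.Rational.Base as ℚ
open import Data.Rational.Base using (ℚ; 0ℚ; 1ℚ; ½)
import Data.Rational.Properties as ℚₚ
open import Data.Sum.Base using (_⊎_; inj₁; inj₂)
open import Function.Base using (_∘_)
open import Function.Bundles using (Func; Injection; Inverse; _⇔_; mk⇔; Equivalence)
open import Function.Properties.Inverse using (Inverse⇒Injection)
open import Level using (Level)
open import Relation.Binary.Bundles using (Setoid)
open import Relation.Binary.PropositionalEquality as ≡ using (_≡_; cong; cong₂; subst)
open import Relation.Nullary.Decidable using (yes; no; from-yes; via-injection)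
open import Relation.Nullary.Negation.Core using (¬_; contradiction)
open import Relation.Unary using (Pred; Decidable)

private
  variable
    c ℓ v p : Level

-- Natural numbers as reals.

module _ where

  open ℝ
  open MonoidMult ℚₚ.+-0-monoid using (×-homo-+) renaming (_×_ to _·_)

  -- The constant value is an `n`-fold sum of `1ℚ`, so that additivity is the law `×-homo-+` of
  -- multiples.
  fromℕ : ℕ → ℝ
  fromℕ n = mkℝ (λ _ → n · 1ℚ) λ ε ε>0 → 0 , λ _ _ _ _ →
    subst (λ q → ℚ.∣ q ∣ ℚ.≤ ε) (≡.sym (ℚₚ.+-inverseʳ (n · 1ℚ)))
      (ℚₚ.<⇒≤ (ℚₚ.positive⁻¹ ε {{ε>0}}))

  private
    ·-mono : ∀ {m n} → m ≤ n → m · 1ℚ ℚ.≤ n · 1ℚ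
    ·-mono {n = zero}  z≤n       = ℚₚ.≤-refl
    ·-mono {n = suc n} z≤n       =
      ℚₚ.+-mono-≤ {0ℚ} {1ℚ} (ℚₚ.nonNegative⁻¹ 1ℚ) (·-mono {n = n} z≤n)
    ·-mono             (s≤s m≤n) = ℚₚ.+-monoʳ-≤ 1ℚ (·-mono m≤n)

    q≤q+ε : ∀ q ε → ℚ.Positive ε → q ℚ.≤ q ℚ.+ ε
    q≤q+ε q ε ε>0 = subst (ℚ._≤ q ℚ.+ ε) (ℚₚ.+-identityʳ q)
      (ℚₚ.+-monoʳ-≤ q (ℚₚ.<⇒≤ (ℚₚ.positive⁻¹ ε {{ε>0}})))

    ¼ : ℚ
    ¼ = ½ ℚ.* ½

  fromℕ-mono : ∀ {m n} → m ≤ n → fromℕ m ≤ᴿ fromℕ n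
  fromℕ-mono m≤n ε ε>0 = 0 , λ _ _ → ℚₚ.≤-trans (·-mono m≤n) (q≤q+ε _ ε ε>0)

  fromℕ-cong : ∀ {m n} → m ≡ n → fromℕ m ≈ᴿ fromℕ n
  fromℕ-cong m≡n = fromℕ-mono (≤-reflexive m≡n) , fromℕ-mono (≤-reflexive (≡.sym m≡n))

  fromℕ-+-≥ : ∀ {k} m n → k ≤ m ℕ.+ n → fromℕ k ≤ᴿ fromℕ m +ᴿ fromℕ n
  fromℕ-+-≥ m n k≤m+n ε ε>0 = 0 , λ _ _ → ℚₚ.≤-trans
    (ℚₚ.≤-trans (·-mono k≤m+n) (ℚₚ.≤-reflexive (×-homo-+ 1ℚ m n))) (q≤q+ε _ ε ε>0)

  fromℕ-+-≤ : ∀ m n → fromℕ m +ᴿ fromℕ n ≤ᴿ fromℕ (m ℕ.+ n)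
  fromℕ-+-≤ m n ε ε>0 = 0 , λ _ _ → ℚₚ.≤-trans
    (ℚₚ.≤-reflexive (≡.sym (×-homo-+ 1ℚ m n))) (q≤q+ε _ ε ε>0)

  -- If `m` exceeded `n`, then at an index late enough for both bounds the two tolerances `¼` would
  -- add up to only `½`, yet would have to bridge a gap of at least `1`.
  fromℕ-between : ∀ {m n} t → fromℕ m ≤ᴿ t → t ≤ᴿ fromℕ n → m ≤ n
  fromℕ-between {m} {n} t m≤t t≤n with m ≤? n | m≤t ¼ _ | t≤n ¼ _
  ... | yes m≤n | _     | _     = m≤n
  ... | no  m≰n | M , f | N , g =
    contradiction (ℚₚ.<-≤-trans ½+n<1+n 1+n≤½+n) (ℚₚ.<-irrefl ≡.refl)
    where
    k = M ⊔ N

    1+n≤½+n : 1ℚ ℚ.+ n · 1ℚ ℚ.≤ ½ ℚ.+ n · 1ℚ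
    1+n≤½+n = begin
      1ℚ ℚ.+ n · 1ℚ           ≤⟨ ·-mono (≰⇒> m≰n) ⟩
      m · 1ℚ                  ≤⟨ f k (m≤m⊔n M N) ⟩
      seq t k ℚ.+ ¼           ≤⟨ ℚₚ.+-monoˡ-≤ ¼ (g k (m≤n⊔m M N)) ⟩
      (n · 1ℚ ℚ.+ ¼) ℚ.+ ¼    ≡⟨ ℚₚ.+-assoc (n · 1ℚ) ¼ ¼ ⟩
      n · 1ℚ ℚ.+ ½            ≡⟨ ℚₚ.+-comm (n · 1ℚ) ½ ⟩
      ½ ℚ.+ n · 1ℚ            ∎
      where open ℚₚ.≤-Reasoning

    ½+n<1+n : ½ ℚ.+ n · 1ℚ ℚ.< 1ℚ ℚ.+ n · 1ℚ
    ½+n<1+n = ℚₚ.+-monoˡ-< (n · 1ℚ) (from-yes (½ ℚₚ.<? 1ℚ))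

-- Interval endpoints that encode a lower bound on a sum of two weights.

module Endpoints (m n : ℕ) where

  open import Data.Nat.Base using (_+_; _*_)

  -- `k` is a weight and `i < n` an index. Scaling by `n` keeps the points of weight `k` in a block
  -- that starts at `k * n` and ends before `suc k * n`, so points of different vertices never
  -- coincide.
  left right : ℕ → ℕ → ℕ
  left k i with m ≤? k + k
  ... | yes _ = (m ∸ k) * n
  ... | no  _ = k * n + i
  right k i with m ≤? k + k
  ... | yes _ = m * n
  ... | no  _ = k * n + i

  left≤right : ∀ k i → left k i ≤ right k i
  left≤right k i with m ≤? k + k
  ... | yes _ = *-monoˡ-≤ n (m∸n≤m m k)
  ... | no  _ = ≤-refl

  private
    a*n≤b*n+i⇒a≤b : ∀ {n i} a b → i < n → a * n ≤ b * n + i → a ≤ b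
    a*n≤b*n+i⇒a≤b {n} {i} a b i<n le = m<1+n⇒m≤n (*-cancelʳ-< n a (suc b) (begin-strict
      a * n      ≤⟨ le ⟩
      b * n + i  <⟨ +-monoʳ-< (b * n) i<n ⟩
      b * n + n  ≡⟨ ℕₚ.+-comm (b * n) n ⟩
      n + b * n  ∎))
      where open ℕₚ.≤-Reasoning

    -- `k + l` is at least twice the smaller weight; for `double-<`, it is at most twice the larger.
    double-≤ : ∀ k l → m ≤ k + k → m ≤ l + l → m ≤ k + l
    double-≤ k l m≤2k m≤2l with ≤-total k l
    ... | inj₁ k≤l = ≤-trans m≤2k (+-monoʳ-≤ k k≤l)
    ... | inj₂ l≤k = ≤-trans m≤2l (+-monoˡ-≤ l l≤k)

    double-< : ∀ k l → ¬ m ≤ k + k → ¬ m ≤ l + l → ¬ m ≤ k + l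
    double-< k l m≰2k m≰2l m≤k+l with ≤-total k l
    ... | inj₁ k≤l = m≰2l (≤-trans m≤k+l (+-monoˡ-≤ l k≤l))
    ... | inj₂ l≤k = m≰2k (≤-trans m≤k+l (+-monoʳ-≤ k l≤k))

    half-< : ∀ k → ¬ m ≤ k + k → suc k ≤ m
    half-< k m≰2k = ≤-trans (s≤s (m≤m+n k k)) (≰⇒> m≰2k)

    m∸k≤l⇒m≤k+l : ∀ k l → m ∸ k ≤ l → m ≤ k + l
    m∸k≤l⇒m≤k+l k l le = ≤-trans (m≤n+m∸n m k) (+-monoʳ-≤ k le)

  -- Two intervals meet when each starts no later than the other ends; this is one of the two
  -- comparisons, the other being its mirror image. Two points cannot occur, since `m ≤ k + l` makes
  -- one of the doubled weights reach `m`.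
  heavy⇒left≤right : ∀ {i} k l j → i < n → m ≤ k + l → left k i ≤ right l j
  heavy⇒left≤right {i} k l j i<n m≤k+l with m ≤? k + k | m ≤? l + l
  ... | yes _    | yes _    = *-monoˡ-≤ n (m∸n≤m m k)
  ... | yes _    | no  _    =
    ≤-trans (*-monoˡ-≤ n (m≤n+o⇒m∸n≤o m k m≤k+l)) (m≤m+n (l * n) j)
  ... | no  m≰2k | yes _    = begin
    k * n + i  ≤⟨ +-monoʳ-≤ (k * n) (<⇒≤ i<n) ⟩
    k * n + n  ≡⟨ ℕₚ.+-comm (k * n) n ⟩
    n + k * n  ≤⟨ *-monoˡ-≤ n (half-< k m≰2k) ⟩
    m * n      ∎
    where open ℕₚ.≤-Reasoning
  ... | no  m≰2k | no  m≰2l = contradiction m≤k+l (double-< k l m≰2k m≰2l)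

  -- For an interval and a point, the index is too small to carry the point into the next block, so
  -- comparing multiples of `n` bounds the sum of the weights. Two points that overlap coincide,
  -- which forces equal weights and then equal indices.
  overlap⇒heavy : ∀ {i j} k l → i < n → j < n → ¬ i ≡ j →
                  left k i ≤ right l j → left l j ≤ right k i → m ≤ k + l
  overlap⇒heavy {i} {j} k l i<n j<n i≢j le le′ with m ≤? k + k | m ≤? l + l
  ... | yes m≤2k | yes m≤2l = double-≤ k l m≤2k m≤2l
  ... | yes _    | no  _    = m∸k≤l⇒m≤k+l k l (a*n≤b*n+i⇒a≤b (m ∸ k) l j<n le)
  ... | no  _    | yes _    =
    subst (m ≤_) (ℕₚ.+-comm l k) (m∸k≤l⇒m≤k+l l k (a*n≤b*n+i⇒a≤b (m ∸ l) k i<n le′))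
  ... | no  _    | no  _    = contradiction i≡j i≢j
    where
    k≡l : k ≡ l
    k≡l = ≤-antisym
      (a*n≤b*n+i⇒a≤b k l j<n (≤-trans (m≤m+n (k * n) i) le))
      (a*n≤b*n+i⇒a≤b l k i<n (≤-trans (m≤m+n (l * n) j) le′))

    i≡j : i ≡ j
    i≡j = +-cancelˡ-≡ (k * n) i j
      (≡.trans (≤-antisym le le′) (cong (λ x → x * n + j) (≡.sym k≡l)))

-- Threshold and interval representations from natural weights.

module WeightedGraph
  {V : Setoid v ℓ} (G : SimpleGraph V) (w : Func V (≡.setoid ℕ)) (m : ℕ)
  (Adj⇔ : ∀ x y → SimpleGraph.Adj G x y ⇔
    (¬ (Setoid._≈_ V x y) × m ≤ Func.to w x ℕ.+ Func.to w y))
  where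

  open Func w using () renaming (to to ⟦_⟧)

  isThresholdGraph : IsThresholdGraph G
  isThresholdGraph = record
    { α    = record { to = fromℕ ∘ ⟦_⟧ ; cong = fromℕ-cong ∘ Func.cong w }
    ; S    = fromℕ m
    ; adj⇔ = λ x y → let open Equivalence (Adj⇔ x y) in mk⇔
        (λ xy → proj₁ (to xy) , fromℕ-+-≥ ⟦ x ⟧ ⟦ y ⟧ (proj₂ (to xy)))
        (λ (x≉y , m≤) → from (x≉y ,
          fromℕ-between (fromℕ ⟦ x ⟧ +ᴿ fromℕ ⟦ y ⟧) m≤ (fromℕ-+-≤ ⟦ x ⟧ ⟦ y ⟧)))
    }

  isIntervalGraph : ∀ {n} → Injection V (≡.setoid (Fin n)) → IsIntervalGraph G
  isIntervalGraph {n} injection = record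
    { left       = endpoint left
    ; right      = endpoint right
    ; left≤right = λ x → fromℕ-mono (l≤r x)
    ; adj⇔       = λ x y → let open Equivalence (Adj⇔ x y) in mk⇔
        (λ xy → let (x≉y , heavy) = to xy in
          -- The larger of the two left endpoints lies in both intervals.
          x≉y , fromℕ (l x ⊔ l y) ,
          (fromℕ-mono (m≤m⊔n (l x) (l y)) , fromℕ-mono (⊔-lub (l≤r x)
            (heavy⇒left≤right ⟦ y ⟧ ⟦ x ⟧ (index x) (index< y)
              (subst (m ≤_) (ℕₚ.+-comm ⟦ x ⟧ ⟦ y ⟧) heavy)))) ,
          (fromℕ-mono (m≤n⊔m (l x) (l y)) , fromℕ-mono (⊔-lub
            (heavy⇒left≤right ⟦ x ⟧ ⟦ y ⟧ (index y) (index< x) heavy) (l≤r y))))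
        (λ (x≉y , t , (lx≤t , t≤rx) , (ly≤t , t≤ry)) → from (x≉y ,
          overlap⇒heavy ⟦ x ⟧ ⟦ y ⟧ (index< x) (index< y)
            (x≉y ∘ Injection.injective injection ∘ Fin.toℕ-injective)
            (fromℕ-between t lx≤t t≤ry) (fromℕ-between t ly≤t t≤rx)))
    }
    where
    open Endpoints m n

    index : Setoid.Carrier V → ℕ
    index x = toℕ (Injection.to injection x)

    index< : ∀ x → index x < n
    index< x = Fin.toℕ<n (Injection.to injection x)

    l r : Setoid.Carrier V → ℕ
    l x = left ⟦ x ⟧ (index x)
    r x = right ⟦ x ⟧ (index x)

    l≤r : ∀ x → l x ≤ r x
    l≤r x = left≤right ⟦ x ⟧ (index x)

    endpoint : (ℕ → ℕ → ℕ) → Func V ℝ-setoid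
    endpoint e = record
      { to   = λ x → fromℕ (e ⟦ x ⟧ (index x))
      ; cong = λ x≈y → fromℕ-cong
          (cong₂ e (Func.cong w x≈y) (cong toℕ (Injection.cong injection x≈y)))
      }

-- Graph parameters with value zero or one.

module _ {V : Setoid v ℓ} (G : SimpleGraph V) where

  open Setoid V using (_≈_)
  open SimpleGraph G using (Adj; irrefl)

  IsComplete : Set _
  IsComplete = ∀ x y → ¬ (x ≈ y) → Adj x y

  module _ (P : SimpleGraph V → Set p) where

    complete⇒minimum≡0 : IsComplete → IsMinimum (IsIntersectionOf P G) 0
    complete⇒minimum≡0 complete =
      ((λ ()) , (λ ()) , λ x y → mk⇔ (λ xy → irrefl xy , λ ()) (complete x y ∘ proj₁)) ,
      λ _ _ → z≤n

    -- `G` alone is a family of size one, while an empty family would make all distinct vertices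
    -- adjacent.
    incomplete⇒minimum≡1 : ¬ IsComplete → P G → IsMinimum (IsIntersectionOf P G) 1
    incomplete⇒minimum≡1 incomplete PG =
      ((λ _ → G) , (λ _ → PG) ,
        λ x y → mk⇔ (λ xy → irrefl xy , λ _ → xy) (λ (_ , xy) → xy zero)) ,
      λ { zero    (_ , _ , G⇔) → contradiction
            (λ x y x≉y → Equivalence.from (G⇔ x y) (x≉y , λ ())) incomplete
        ; (suc d) _            → s≤s z≤n
        }

bounded-max : {P : Pred ℕ p} → Decidable P → P 0 → ∀ m →
              ∃[ k ] k ≤ m × P k × ∀ j → j ≤ m → P j → j ≤ k
bounded-max P? P0 zero = 0 , z≤n , P0 , λ j j≤0 _ → j≤0
bounded-max P? P0 (suc m) with P? (suc m) | bounded-max P? P0 m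
... | yes Pm | _                      = suc m , ≤-refl , Pm , λ j j≤1+m _ → j≤1+m
... | no ¬Pm | k , k≤m , Pk , maximal = k , m≤n⇒m≤1+n k≤m , Pk , λ j j≤1+m Pj →
  maximal j (m<1+n⇒m≤n (≤∧≢⇒< j≤1+m λ { ≡.refl → ¬Pm Pj })) Pj

-- Divisibility by powers of a prime element.

HasNoZeroDivisors : CommutativeRing c ℓ → Set _
HasNoZeroDivisors R = ∀ {x y} → x * y ≈ 0# → x ≈ 0# ⊎ y ≈ 0#
  where open CommutativeRing R

module PrimePowers
  (R : CommutativeRing c ℓ) (integral : HasNoZeroDivisors R) (π : CommutativeRing.Carrier R)
  (π-prime : Prime (Semiring.rawSemiring (CommutativeRing.semiring R)) π)
  where

  open CommutativeRing R
  open Prime π-prime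
  open SemiringDivisibility semiring using (_∣_; ∣-respʳ-≈; ∣-respˡ-≈; ∣ʳ-refl; ∣ʳ-trans; ε∣ʳ_)
  open CommutativeSemigroupDivisibility *-commutativeSemigroup
    using (x∣xy; ∙-cong-∣; x∣y⇒zx∣zy)
  open CommutativeSemigroupProperties *-commutativeSemigroup using (x∙yz≈y∙xz)
  open GroupProperties +-group using (x≈y⇒x∙y⁻¹≈ε; x∙y⁻¹≈ε⇒x≈y)
  open RingProperties ring using (x[y-z]≈xy-xz)
  open SemiringExp semiring using (^-homo-*) renaming (_^_ to _^^_)

  π*-cancel : ∀ {x y} → π * x ≈ π * y → x ≈ y
  π*-cancel {x} {y} πx≈πy
    with integral (trans (x[y-z]≈xy-xz π x y) (x≈y⇒x∙y⁻¹≈ε πx≈πy))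
  ... | inj₁ π≈0   = contradiction π≈0 p≉0
  ... | inj₂ x-y≈0 = x∙y⁻¹≈ε⇒x≈y x y x-y≈0

  π*-cancel-∣ : ∀ {x y} → π * x ∣ π * y → x ∣ y
  π*-cancel-∣ {x} (q , q[πx]≈πy) = q , π*-cancel (trans (x∙yz≈y∙xz π q x) q[πx]≈πy)

  π^-mono-∣ : ∀ {j k} → j ≤ k → π ^^ j ∣ π ^^ k
  π^-mono-∣ {k = k} z≤n       = ε∣ʳ (π ^^ k)
  π^-mono-∣         (s≤s j≤k) = x∣y⇒zx∣zy π (π^-mono-∣ j≤k)

  π^1+k∤π^k : ∀ k → ¬ π ^^ suc k ∣ π ^^ k
  π^1+k∤π^k zero    π∣1 = p∤1 (∣-respˡ-≈ (*-identityʳ π) π∣1)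
  π^1+k∤π^k (suc k) div = π^1+k∤π^k k (π*-cancel-∣ div)

  π^-*-cancel-∣ : ∀ j {k x} → π ^^ (j ℕ.+ k) ∣ π ^^ j * x → π ^^ k ∣ x
  π^-*-cancel-∣ zero    {k} {x} div = ∣-respʳ-≈ (*-identityˡ x) div
  π^-*-cancel-∣ (suc j) {k} {x} div =
    π^-*-cancel-∣ j (π*-cancel-∣ (∣-respʳ-≈ (*-assoc π (π ^^ j) x) div))

  π^-*-mono-∣ : ∀ j {k x} → π ^^ k ∣ x → π ^^ (j ℕ.+ k) ∣ π ^^ j * x
  π^-*-mono-∣ j {k} div = ∣-respˡ-≈ (sym (^-homo-* π j k)) (x∣y⇒zx∣zy (π ^^ j) div)

  -- By primality `π` divides `x` or `y`. Cancelling it from that factor leaves a product divisible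
  -- by `π ^^ m`; the induction splits this, and the exponent of the reduced factor goes up by one.
  π^-split-∣ : ∀ m {x y} → π ^^ m ∣ x * y → ∃[ j ] ∃[ k ] j ℕ.+ k ≡ m × π ^^ j ∣ x × π ^^ k ∣ y
  π^-split-∣ zero    {x} {y} _   = 0 , 0 , ≡.refl , (ε∣ʳ x) , (ε∣ʳ y)
  π^-split-∣ (suc m) {x} {y} div with split-∣ (∣ʳ-trans (x∣xy π (π ^^ m)) div)
  ... | inj₁ (q , qπ≈x)
      with j , k , ≡.refl , j∣ , k∣ ← π^-split-∣ m {q} {y} (π*-cancel-∣ (∣-respʳ-≈
             (trans (*-congʳ (trans (sym qπ≈x) (*-comm q π))) (*-assoc π q y)) div))
      = suc j , k , ≡.refl , ∣-respʳ-≈ (trans (*-comm π q) qπ≈x) (x∣y⇒zx∣zy π j∣) , k∣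
  ... | inj₂ (q , qπ≈y)
      with j , k , ≡.refl , j∣ , k∣ ← π^-split-∣ m {x} {q} (π*-cancel-∣ (∣-respʳ-≈
             (trans (*-congˡ (trans (sym qπ≈y) (*-comm q π))) (x∙yz≈y∙xz x π q)) div))
      = j , suc k , +-suc j k , j∣ , ∣-respʳ-≈ (trans (*-comm π q) qπ≈y) (x∣y⇒zx∣zy π k∣)

  ∣-cancel-+ʳ : ∀ {x y z} → x ∣ y + z → x ∣ z → x ∣ y
  ∣-cancel-+ʳ {x} {y} {z} x∣y+z x∣z = resp
    (trans (+-congˡ (-1*x≈-x z)) (trans (+-assoc y z (- z))
      (trans (+-congˡ (-‿inverseʳ z)) (+-identityʳ y))))
    (+-closed x∣y+z (*-closed (- 1#) x∣z))
    where
    open Ideal (⟨_⟩ R x)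
    open RingProperties ring using (-1*x≈-x)

  -- The truncated valuation on the quotient.

  module Quotient
    (m : ℕ) (g : Carrier) (g∣π^m : g ∣ π ^^ m) (π^m∣g : π ^^ m ∣ g)
    (finite : IsFinite (CommutativeRing.setoid (_/_ R (⟨_⟩ R g))))
    where

    private
      Q = _/_ R (⟨_⟩ R g)
      module Q = CommutativeRing Q
      enumeration = Inverse⇒Injection (proj₂ finite)

      x-0≈x : ∀ x → x + - 0# ≈ x
      x-0≈x x = trans (+-congˡ -0#≈0#) (+-identityʳ x)
        where open RingProperties ring using (-0#≈0#)

    ≈0⇒π^m∣ : ∀ {x} → x Q.≈ 0# → π ^^ m ∣ x
    ≈0⇒π^m∣ {x} x≈0 = ∣ʳ-trans π^m∣g (∣-respʳ-≈ (x-0≈x x) x≈0)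

    π^m∣⇒≈0 : ∀ {x} → π ^^ m ∣ x → x Q.≈ 0#
    π^m∣⇒≈0 {x} π^m∣x = ∣-respʳ-≈ (sym (x-0≈x x)) (∣ʳ-trans g∣π^m π^m∣x)

    private
      -- For k ≤ m this says πᵏ ∣ x, in a form decidable in the finite ring Q.
      Divides : Carrier → Pred ℕ _
      Divides x k = π ^^ (m ∸ k) * x Q.≈ 0#

      -- Equality in `Q` is decided by comparing indices in the enumeration.
      divides? : ∀ x → Decidable (Divides x)
      divides? x k = via-injection enumeration Fin._≟_ (π ^^ (m ∸ k) * x) 0#

      max : ∀ x → ∃[ k ] k ≤ m × Divides x k × ∀ j → j ≤ m → Divides x j → j ≤ k
      -- For `k = 0` the condition says that `π ^^ m * x` vanishes in `Q`, which always holds.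
      max x = bounded-max (divides? x) (π^m∣⇒≈0 (x∣xy (π ^^ m) x)) m

    -- `Divides` is stated in `Q`, so congruent elements admit the same exponents, and maximality
    -- gives both inequalities.
    order : Func Q.setoid (≡.setoid ℕ)
    order = record
      { to   = λ x → proj₁ (max x)
      ; cong = λ x≈y → ≤-antisym (order-mono x≈y) (order-mono (Q.sym x≈y))
      }
      where
      order-mono : ∀ {x y} → x Q.≈ y → proj₁ (max x) ≤ proj₁ (max y)
      order-mono {x} {y} x≈y with max x | max y
      ... | k , k≤m , Dk , _ | _ , _ , _ , maximal =
        maximal k k≤m (Q.trans (Q.*-congˡ {π ^^ (m ∸ k)} {y} {x} (Q.sym x≈y)) Dk)

    private
      ord = Func.to order

    -- As `k ≤ m`, the exponents `m ∸ k` and `k` add up to `m`, so cancelling `π ^^ (m ∸ k)` turns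
    -- `Divides` back into divisibility in `R`.
    π^order∣ : ∀ x → π ^^ ord x ∣ x
    π^order∣ x with max x
    ... | k , k≤m , Dk , _ = π^-*-cancel-∣ (m ∸ k)
      (subst (λ e → π ^^ e ∣ π ^^ (m ∸ k) * x) (≡.sym (m∸n+n≡m k≤m)) (≈0⇒π^m∣ Dk))

    order-maximal : ∀ x k → k ≤ m → π ^^ k ∣ x → k ≤ ord x
    order-maximal x k k≤m div = proj₂ (proj₂ (proj₂ (max x))) k k≤m (π^m∣⇒≈0
      (subst (λ e → π ^^ e ∣ π ^^ (m ∸ k) * x) (m∸n+n≡m k≤m) (π^-*-mono-∣ (m ∸ k) div)))

    -- Splitting `π ^^ m` between the factors gives exponents with sum `m`, each at most the order
    -- of its factor.
    xy≈0⇒m≤order+order : ∀ x y → x * y Q.≈ 0# → m ≤ ord x ℕ.+ ord y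
    xy≈0⇒m≤order+order x y xy≈0 with π^-split-∣ m (≈0⇒π^m∣ xy≈0)
    ... | j , k , ≡.refl , j∣x , k∣y = +-mono-≤
      (order-maximal x j (m≤m+n j k) j∣x) (order-maximal y k (m≤n+m k j) k∣y)

    m≤order+order⇒xy≈0 : ∀ x y → m ≤ ord x ℕ.+ ord y → x * y Q.≈ 0#
    m≤order+order⇒xy≈0 x y m≤ = π^m∣⇒≈0 (∣ʳ-trans (π^-mono-∣ m≤)
      (∣-respˡ-≈ (sym (^-homo-* π (ord x) (ord y))) (∙-cong-∣ (π^order∣ x) (π^order∣ y))))

    -- The zero divisor graph of the quotient.

    private
      V = ZeroDivisorVertices Q

      weight : Func V (≡.setoid ℕ)
      weight = record { to = ord ∘ proj₁ ; cong = Func.cong order }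

      Γ-Adj⇔ : ∀ x y → SimpleGraph.Adj (Γ Q) x y ⇔
               (¬ (Setoid._≈_ V x y) × m ≤ Func.to weight x ℕ.+ Func.to weight y)
      Γ-Adj⇔ (x , _) (y , _) = mk⇔
        (λ (x≉y , xy≈0) → x≉y , xy≈0⇒m≤order+order x y xy≈0)
        (λ (x≉y , m≤)   → x≉y , m≤order+order⇒xy≈0 x y m≤)

      open WeightedGraph (Γ Q) weight m Γ-Adj⇔

    Γ-isThresholdGraph : IsThresholdGraph (Γ Q)
    Γ-isThresholdGraph = isThresholdGraph

    Γ-isIntervalGraph : IsIntervalGraph (Γ Q)
    Γ-isIntervalGraph = isIntervalGraph (record
      { to        = Injection.to enumeration ∘ proj₁
      ; cong      = Injection.cong enumeration
      ; injective = Injection.injective enumeration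
      })

    -- When `π ^^ m` is split between `x` and `s`, the share of `x` is positive, as otherwise all of
    -- it would divide `s`, making `s` zero in `Q`.
    zeroDivisor⇒π∣ : ∀ {x} → IsZeroDivisor Q x → π ∣ x
    zeroDivisor⇒π∣ {x} (s , s≉0 , xs≈0) with π^-split-∣ m (≈0⇒π^m∣ xs≈0)
    ... | zero  , _ , ≡.refl , _   , m∣s = contradiction (π^m∣⇒≈0 m∣s) s≉0
    ... | suc j , _ , _      , j∣x , _   = ∣ʳ-trans (x∣xy π (π ^^ j)) j∣x

    m≤2⇒Γ-isComplete : m ≤ 2 → IsComplete (Γ Q)
    m≤2⇒Γ-isComplete m≤2 (x , x-zd , _) (y , y-zd , _) x≉y =
      x≉y , π^m∣⇒≈0 (∣ʳ-trans (π^-mono-∣ m≤2)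
        (∣-respˡ-≈ (*-congˡ (sym (*-identityʳ π)))
          (∙-cong-∣ (zeroDivisor⇒π∣ x-zd) (zeroDivisor⇒π∣ y-zd))))

    3≤m⇒Γ-¬isComplete : 3 ≤ m → ¬ IsComplete (Γ Q)
    3≤m⇒Γ-¬isComplete (s≤s (s≤s (s≤s {n = k} z≤n))) complete =
      π^m∤πx y π²∤y (≈0⇒π^m∣ (proj₂ (complete
        (vertex π ∣ʳ-refl π²∤π) (vertex y π∣y π²∤y) π≉y)))
      where
      -- Since `m = 3 + k`, `z` is the power with exponent `m - 1`: nonzero in `Q`, but killed by
      -- every multiple of `π`. It serves both as the annihilator in `vertex` and as the difference
      -- of the two vertices.
      z y : Carrier
      z = π ^^ suc (suc k)
      y = π + z

      2≤2+k : 2 ≤ suc (suc k)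
      2≤2+k = s≤s (s≤s z≤n)

      π∣y : π ∣ y
      π∣y = Ideal.+-closed (⟨_⟩ R π) ∣ʳ-refl (x∣xy π (π ^^ suc k))

      π²∤π : ¬ π ^^ 2 ∣ π
      π²∤π div = π^1+k∤π^k 1 (∣-respʳ-≈ (sym (*-identityʳ π)) div)

      π²∤y : ¬ π ^^ 2 ∣ y
      π²∤y div = π²∤π (∣-cancel-+ʳ div (π^-mono-∣ 2≤2+k))

      -- Cancelling one `π` leaves exponent `m - 1`, which is at least `2`.
      π^m∤πx : ∀ x → ¬ π ^^ 2 ∣ x → ¬ π ^^ m ∣ π * x
      π^m∤πx x π²∤x div = π²∤x (∣ʳ-trans (π^-mono-∣ 2≤2+k) (π*-cancel-∣ div))

      vertex : ∀ x → π ∣ x → ¬ π ^^ 2 ∣ x → Setoid.Carrier V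
      vertex x π∣x π²∤x = x , (z ,
        (λ z≈0 → π^1+k∤π^k (suc (suc k)) (≈0⇒π^m∣ z≈0)) ,
        π^m∣⇒≈0 (∙-cong-∣ π∣x ∣ʳ-refl)) ,
        λ x≈0 → π²∤x (∣ʳ-trans (π^-mono-∣ (m≤n⇒m≤1+n 2≤2+k)) (≈0⇒π^m∣ x≈0))

      π≉y : ¬ π Q.≈ y
      -- The difference of `y` and `π` is `z`, which `π ^^ m` does not divide.
      π≉y π≈y = π^1+k∤π^k (suc (suc k)) (∣ʳ-trans π^m∣g
        (∣-respʳ-≈ (xyx⁻¹≈y π z) (Q.sym {π} {y} π≈y)))
        where open AbelianGroupProperties +-abelianGroup using (xyx⁻¹≈y)

    Γ-dimensions : (m ≤ 2 → HasThresholdDimension (Γ Q) 0 × HasBoxicity (Γ Q) 0) ×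
                   (3 ≤ m → HasThresholdDimension (Γ Q) 1 × HasBoxicity (Γ Q) 1)
    Γ-dimensions =
      (λ m≤2 →
        complete⇒minimum≡0 (Γ Q) IsThresholdGraph (m≤2⇒Γ-isComplete m≤2) ,
        complete⇒minimum≡0 (Γ Q) IsIntervalGraph (m≤2⇒Γ-isComplete m≤2)) ,
      (λ 3≤m →
        incomplete⇒minimum≡1 (Γ Q) IsThresholdGraph (3≤m⇒Γ-¬isComplete 3≤m) Γ-isThresholdGraph ,
        incomplete⇒minimum≡1 (Γ Q) IsIntervalGraph (3≤m⇒Γ-¬isComplete 3≤m) Γ-isIntervalGraph)

lemma77 :
    ∀ {c ℓ} (R : CommutativeRing c ℓ) → IsPrincipalIdealDomain R →
    let open CommutativeRing R
        𝓡 = Semiring.rawSemiring semiring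
    in
    (g : Carrier) →
    let I = ⟨_⟩ R g
        Q = R / I
    in
    IsProper R I → ¬ IsPrimeIdeal R I → IsFinite (CommutativeRing.setoid Q) →
    (u p₁ : Carrier) (m₁ : ℕ) →
    IsUnit R u → Prime 𝓡 p₁ → 1 ≤ m₁ →
    g ≈ u * _^_ 𝓡 p₁ m₁ →
    (m₁ ≤ 2 → HasThresholdDimension (Γ Q) 0 × HasBoxicity (Γ Q) 0) ×
    (3 ≤ m₁ → HasThresholdDimension (Γ Q) 1 × HasBoxicity (Γ Q) 1)
lemma77 R domain g _ _ finite u p₁ m₁ (u⁻¹ , u⁻¹u≈1) p₁-prime _ g≈up₁^m₁ =
  Γ-dimensions
  where
  open CommutativeRing R
  open PrimePowers R (IsPrincipalIdealDomain.xy≈0⇒x≈0∨y≈0 domain) p₁ p₁-prime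

  -- Together with the cofactor `u` in the other direction, this makes `g` and the power of `p₁`
  -- associates.
  g∣p₁^m₁ = u⁻¹ , trans (*-congˡ g≈up₁^m₁) (trans (sym (*-assoc u⁻¹ u _))
    (trans (*-congʳ u⁻¹u≈1) (*-identityˡ _)))

  open Quotient m₁ g g∣p₁^m₁ (u , sym g≈up₁^m₁) finite using (Γ-dimensions)
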